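{- Let $T=\{2143,2314,2341\}$. Then $$F_T(x)=\frac{1-6x+10x^2-3x^3+x^4}{(1-3x+x^2)(1-4x+2x^2)}.$$
   Context: $S_n(T)$ denotes the set of permutations $\pi$ of $[n]=\{1,\dots,n\}$ (one-line notation) that avoid every pattern $\tau\in T$, i.e. no subsequence of $\pi$ is order-isomorphic to $\tau$. $F_T(x)=\sum_{n\ge 0}|S_n(T)|x^n$, a formal power series, with $|S_0(T)|=1$. -}

module Defs where

open import Data.Fin.Base using (Fin; cast)
open import Data.Fin.Properties using (all?)
open import Data.Integer.Base as ℤ using (ℤ; +_)
open import Data.List.Base
  using (List; []; _∷_; length; lookup; map; foldr; filter; upTo; cartesianProductWith)
open import Data.List.Membership.Propositional using (_∈_)
open import Data.List.Membership.Propositional.Properties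
  using (∈-cartesianProductWith⁺; ∈-cartesianProductWith⁻; ∈-filter⁺; ∈-filter⁻)
open import Data.List.Properties using (∷-injective)
open import Data.List.Relation.Binary.Sublist.Propositional using (_⊆_; []; _∷_; _∷ʳ_)
open import Data.List.Relation.Unary.All as All using (All; []; _∷_)
open import Data.List.Relation.Unary.AllPairs using ([]; _∷_)
open import Data.List.Relation.Unary.Any using (here)
open import Data.List.Relation.Unary.Unique.Propositional using (Unique)
import Data.List.Relation.Unary.Unique.Propositional.Properties as Unique
open import Data.Nat.Base using (ℕ; zero; suc; _∸_; _<_)
open import Data.Nat.Properties using (_≟_; _<?_; suc-injective)
open import Data.List.Relation.Unary.Unique.DecPropositional _≟_ using (unique?)
open import Data.Product.Base using (Σ-syntax; ∃-syntax; _×_; _,_)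
open import Data.Sum.Base using (_⊎_; inj₁; inj₂; [_,_]′)
open import Function.Bundles using (_⇔_; mk⇔; module Equivalence)
open import Relation.Binary.PropositionalEquality using (_≡_; _≗_; refl; cong)
open import Relation.Nullary.Decidable
  using (Dec; yes; no; map′; ¬?; _×-dec_; _→-dec_; _⊎-dec_)
open import Relation.Nullary.Negation using (¬_)
open import Relation.Unary using (Pred; Decidable)

Word : Set
Word = List ℕ

[1⋯_] : ℕ → List ℕ
[1⋯ n ] = map suc (upTo n)

-- One-line notation: n pairwise distinct letters taken from 1, …, n.
IsPermutation : ℕ → Word → Set
IsPermutation n π = (length π ≡ n × All (_∈ [1⋯ n ]) π) × Unique π

OrderIsomorphic : Word → Word → Set
OrderIsomorphic σ τ =
  Σ[ eq ∈ length σ ≡ length τ ]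
    (∀ (i j : Fin (length σ)) →
      lookup σ i < lookup σ j ⇔ lookup τ (cast eq i) < lookup τ (cast eq j))

-- Here _⊆_ is the (not necessarily contiguous) subsequence relation.
Contains : Word → Word → Set
Contains π τ = ∃[ σ ] (σ ⊆ π × OrderIsomorphic σ τ)

Avoids : Word → Word → Set
Avoids π τ = ¬ Contains π τ

AvoidsAll : List Word → Word → Set
AvoidsAll T π = All (Avoids π) T

orderIsomorphic? : ∀ σ τ → Dec (OrderIsomorphic σ τ)
orderIsomorphic? σ τ with length σ ≟ length τ
... | no  ≢  = no λ (eq , _) → ≢ eq
... | yes eq = map′ (eq ,_) (λ { (eq′ , iso) → iso })
  (all? λ i → all? λ j →
    (lookup σ i <? lookup σ j)
      ⇔? (lookup τ (cast eq i) <? lookup τ (cast eq j)))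
  where
  _⇔?_ : ∀ {A B : Set} → Dec A → Dec B → Dec (A ⇔ B)
  a? ⇔? b? = map′ (λ (f , g) → mk⇔ f g)
    (λ e → Equivalence.to e , Equivalence.from e)
    ((a? →-dec b?) ×-dec (b? →-dec a?))

anySubsequence? : ∀ {p} {P : Pred Word p} → Decidable P →
                  ∀ π → Dec (∃[ σ ] (σ ⊆ π × P σ))
anySubsequence? P? [] =
  map′ (λ p → [] , [] , p) (λ { (_ , [] , p) → p }) (P? [])
anySubsequence? {P = P} P? (x ∷ π) =
  map′ [ (λ (σ , s , p) → σ , x ∷ʳ s , p)
       , (λ (σ , s , p) → x ∷ σ , refl ∷ s , p) ]′
       split
       (anySubsequence? P? π ⊎-dec anySubsequence? (λ σ → P? (x ∷ σ)) π)
  where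
  split : ∃[ σ ] (σ ⊆ x ∷ π × P σ) →
          ∃[ σ ] (σ ⊆ π × P σ) ⊎ ∃[ σ ] (σ ⊆ π × P (x ∷ σ))
  split (σ     , _ ∷ʳ s   , p) = inj₁ (σ , s , p)
  split (_ ∷ σ , refl ∷ s , p) = inj₂ (σ , s , p)

contains? : ∀ π τ → Dec (Contains π τ)
contains? π τ = anySubsequence? (λ σ → orderIsomorphic? σ τ) π

avoidsAll? : ∀ T → Decidable (AvoidsAll T)
avoidsAll? T π = All.all? (λ τ → ¬? (contains? π τ)) T

words : List ℕ → ℕ → List Word
words A zero    = [] ∷ []
words A (suc k) = cartesianProductWith _∷_ A (words A k)

permutations : ℕ → List Word
permutations n = filter unique? (words [1⋯ n ] n)

S : ℕ → List Word → List Word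
S n T = filter (avoidsAll? T) (permutations n)

-- S n T lists the T-avoiding permutations of [n], each exactly once
-- (∈-S⇔ and S-unique), so its length is the cardinality |Sₙ(T)|.

∈-words⁺ : ∀ {A k w} → length w ≡ k → All (_∈ A) w → w ∈ words A k
∈-words⁺ {w = []}    refl []         = here refl
∈-words⁺ {w = _ ∷ w} refl (x∈A ∷ w∈) =
  ∈-cartesianProductWith⁺ _∷_ x∈A (∈-words⁺ {w = w} refl w∈)

∈-words⁻ : ∀ {A} k {w} → w ∈ words A k → length w ≡ k × All (_∈ A) w
∈-words⁻ zero (here refl) = refl , []
∈-words⁻ {A} (suc k) w∈
  with _ , _ , x∈A , v∈ , refl ← ∈-cartesianProductWith⁻ _∷_ A (words A k) w∈
  with len , v∈A ← ∈-words⁻ k v∈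
  = cong suc len , x∈A ∷ v∈A

∈-S⇔ : ∀ {n T π} → π ∈ S n T ⇔ (IsPermutation n π × AvoidsAll T π)
∈-S⇔ {n} {T} {π} = mk⇔ to from
  where
  to : π ∈ S n T → IsPermutation n π × AvoidsAll T π
  to π∈S with π∈P , av ← ∈-filter⁻ (avoidsAll? T) {xs = permutations n} π∈S
         with π∈W , uq ← ∈-filter⁻ unique? {xs = words [1⋯ n ] n} π∈P
         = (∈-words⁻ n π∈W , uq) , av

  from : IsPermutation n π × AvoidsAll T π → π ∈ S n T
  from (((len , ∈[n]) , uq) , av) =
    ∈-filter⁺ (avoidsAll? T) (∈-filter⁺ unique? (∈-words⁺ len ∈[n]) uq) av

words-unique : ∀ {A} → Unique A → ∀ k → Unique (words A k)
words-unique A! zero    = [] ∷ []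
words-unique A! (suc k) =
  Unique.cartesianProductWith⁺ _∷_ ∷-injective A! (words-unique A! k)

S-unique : ∀ n T → Unique (S n T)
S-unique n T = Unique.filter⁺ (avoidsAll? T) (Unique.filter⁺ unique?
  (words-unique (Unique.map⁺ suc-injective (Unique.upTo⁺ n)) n))

-- A formal power series over ℤ is its sequence of coefficients;
-- two series are equal when they agree pointwise (_≗_).
Series : Set
Series = ℕ → ℤ

polynomial : List ℤ → Series
polynomial []       _       = + 0
polynomial (c ∷ cs) zero    = c
polynomial (c ∷ cs) (suc n) = polynomial cs n

infixl 7 _*_

_*_ : Series → Series → Series
(f * g) n = foldr ℤ._+_ (+ 0) (map (λ i → f i ℤ.* g (n ∸ i)) (upTo (suc n)))

-- f = p / q in ℤ[[x]].  A q with constant term 1 is a unit of ℤ[[x]], so f is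
-- the only series with f * q ≗ p.
infix 4 _≗_/_

_≗_/_ : Series → Series → Series → Set
f ≗ p / q = q 0 ≡ + 1 × f * q ≗ p

F : List Word → Series
F T n = + length (S n T)

module Submission where

-- Write a permutation of [n + 1] as (m + 1) followed by a relabelled permutation
-- v of [n], and let q = n − m count the letters of v above m.  If m = 0, or
-- q ≤ 1, the first letter takes part in no forbidden pattern.  If m ≥ 1 and q ≥ 2,
-- then either v starts with its maximum, which may be deleted, or v is a permutation
-- of [m] avoiding 231 and 2143 followed by m + 1, …, m + q.  So with fₙ = |Sₙ(T)|
-- and gₙ = |Sₙ(231, 2143)| the number X(m, q) of choices for v satisfies
--   X(0, q) = f_q,  X(m, 0) = f_m,  X(m, 1) = f_{m+1},  X(m, q+2) = X(m, q+1) + g_m.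
-- The same decomposition for g gives g_{n+1} = g_n + g_1 + ⋯ + g_n, and summing over
-- m + q = n yields f_{n+4} − 4 f_{n+3} + 2 f_{n+2} = g_1 + ⋯ + g_{n+1}, a sequence
-- annihilated by 1 − 3x + x².

open import Defs
open import Data.Empty using (⊥; ⊥-elim)
open import Data.Fin.Base using (zero; suc)
import Data.Fin.Base as Fin
open import Data.Integer.Base using (ℤ; +_; -_)
open import Data.Integer.Tactic.RingSolver using () renaming (solve-∀ to solveℤ-∀)
import Data.Integer.Base as ℤ
import Data.Integer.Properties as ℤ
open import Data.List.Base using (List; []; _∷_; _++_; _∷ʳ_; [_]; length; lookup; map; foldr)
open import Data.List.Membership.Propositional using (_∈_; _∉_)
open import Data.List.Membership.Propositional.Properties
  using (∈-map⁺; ∈-map⁻; ∈-upTo⁺; ∈-upTo⁻; ∈-++⁺ˡ; ∈-++⁺ʳ; ∈-++⁻; ∈-∃++)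
open import Data.List.Membership.Propositional.Properties.WithK using (unique∧set⇒bag)
open import Data.List.Properties
  using (length-map; length-++; ∷-injectiveˡ; ∷-injectiveʳ; ∷ʳ-injectiveˡ; map-injective; map-upTo; map-applyUpTo)
open import Data.List.Relation.Binary.BagAndSetEquality using (∼bag⇒↭)
open import Data.List.Relation.Binary.Permutation.Propositional using (_↭_; ↭-sym; ↭⇒↭ₛ)
open import Data.List.Relation.Binary.Permutation.Propositional.Properties using (↭-length; All-resp-↭; ∷↭∷ʳ)
open import Data.List.Relation.Binary.Permutation.Setoid.Properties using (Unique-resp-↭)
open import Data.List.Relation.Binary.Sublist.Propositional
  using (_⊆_; []; _∷_; ⊆-trans; from∈; to∈; minimum)
  renaming (_∷ʳ_ to _∷ˢ_; lookup to ⊆-lookup)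
import Data.List.Relation.Binary.Sublist.Propositional.Properties as Sublist
open import Data.List.Relation.Unary.All as All using (All; []; _∷_)
import Data.List.Relation.Unary.All.Properties as All
open import Data.List.Relation.Unary.AllPairs using ([]; _∷_)
open import Data.List.Relation.Unary.Any using (here; there)
open import Data.List.Relation.Unary.Unique.Propositional using (Unique)
import Data.List.Relation.Unary.Unique.Propositional.Properties as Unique
open import Data.Nat.Base using (ℕ; zero; suc; _+_; _∸_; _≤_; _<_; z≤n; s≤s; s≤s⁻¹)
open import Data.Nat.Properties
open import Data.Nat.Tactic.RingSolver using () renaming (solve-∀ to solveℕ-∀)
open import Data.Product.Base using (∃-syntax; ∃₂; _×_; _,_; proj₁; proj₂)
open import Data.Sum.Base using (_⊎_; inj₁; inj₂; [_,_]′)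
open import Function.Base using (_∘_)
open import Function.Bundles using (_⇔_; mk⇔; module Equivalence)
open import Function.Definitions using (Injective)
open import Relation.Binary.Definitions using (tri<; tri≈; tri>)
open import Relation.Binary.PropositionalEquality
  using (_≡_; _≢_; _≗_; refl; sym; trans; cong; subst; ≢-sym; setoid; module ≡-Reasoning)
open import Relation.Nullary.Decidable using (yes; no)
open import Relation.Nullary.Negation using (¬_; contradiction)

open Equivalence using (to; from)

-- Counting

-- A count is carried by a duplicate-free list, so that disjoint unions and injective images become
-- `_++_` and `map`.
record HasCard {A : Set} (P : A → Set) (n : ℕ) : Set where
  constructor enum
  field
    elements : List A
    unique   : Unique elements
    elements⇔ : ∀ {x} → x ∈ elements ⇔ P x
    size     : length elements ≡ n

module _ {A : Set} {P Q : A → Set} where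

  card-cong : ∀ {n} → (∀ {x} → P x → Q x) → (∀ {x} → Q x → P x) → HasCard P n → HasCard Q n
  card-cong f g (enum xs xs! xs⇔ eq) = enum xs xs! (mk⇔ (f ∘ to xs⇔) (from xs⇔ ∘ g)) eq

  card-⊎ : ∀ {m n} → (∀ {x} → P x → ¬ Q x) → HasCard P m → HasCard Q n →
           HasCard (λ x → P x ⊎ Q x) (m + n)
  card-⊎ disj (enum xs xs! xs⇔ refl) (enum ys ys! ys⇔ refl) = enum (xs ++ ys)
    (Unique.++⁺ xs! ys! (λ (x∈ , y∈) → disj (to xs⇔ x∈) (to ys⇔ y∈)))
    (mk⇔ (λ x∈ → [ (λ i → inj₁ (to xs⇔ i)) , (λ i → inj₂ (to ys⇔ i)) ]′ (∈-++⁻ xs x∈))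
         [ (λ p → ∈-++⁺ˡ (from xs⇔ p)) , (λ q → ∈-++⁺ʳ xs (from ys⇔ q)) ]′)
    (length-++ xs)

-- Two duplicate-free lists with the same members are equal as bags, hence permutations of each
-- other. The counting recurrences arise by enumerating one set in two ways.
card-unique : ∀ {A : Set} {P : A → Set} {m n} → HasCard P m → HasCard P n → m ≡ n
card-unique (enum xs xs! xs⇔ refl) (enum ys ys! ys⇔ refl) =
  ↭-length (∼bag⇒↭ (unique∧set⇒bag xs! ys!
    (mk⇔ (from ys⇔ ∘ to xs⇔) (from xs⇔ ∘ to ys⇔))))

card-image : ∀ {A B : Set} {P : A → Set} {f : A → B} {n} → Injective _≡_ _≡_ f →
             HasCard P n → HasCard (λ y → ∃[ x ] (P x × y ≡ f x)) n
card-image {f = f} inj (enum xs xs! xs⇔ refl) = enum (map f xs)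
  (Unique.map⁺ inj xs!)
  (mk⇔ (λ y∈ → let x , x∈ , eq = ∈-map⁻ f y∈ in x , to xs⇔ x∈ , eq)
       (λ { (x , p , refl) → ∈-map⁺ f (from xs⇔ p) }))
  (length-map f xs)

antidiagonalSum : (ℕ → ℕ → ℕ) → ℕ → ℕ
antidiagonalSum h zero    = h 0 0
antidiagonalSum h (suc n) = h 0 (suc n) + antidiagonalSum (h ∘ suc) n

card-antidiagonal : ∀ {A : Set} {P : ℕ → ℕ → A → Set} {h} n →
  (∀ {m q m′ q′ x} → P m q x → P m′ q′ x → m ≡ m′) →
  (∀ m q → HasCard (P m q) (h m q)) →
  HasCard (λ x → ∃₂ λ m q → m + q ≡ n × P m q x) (antidiagonalSum h n)
card-antidiagonal zero disj c = card-cong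
  (λ p → 0 , 0 , refl , p)
  (λ { (zero , zero , refl , p) → p })
  (c 0 0)
card-antidiagonal (suc n) disj c = card-cong
  [ (λ p → 0 , suc n , refl , p)
  , (λ { (m , q , eq , p) → suc m , q , cong suc eq , p }) ]′
  (λ { (zero , q , refl , p) → inj₁ p
     ; (suc m , q , eq , p) → inj₂ (m , q , suc-injective eq , p) })
  (card-⊎ (λ { p (m , q , _ , p′) → 0≢1+n (disj p p′) })
    (c 0 (suc n))
    (card-antidiagonal n (λ p p′ → suc-injective (disj p p′)) (c ∘ suc)))

-- Permutations

∈[1⋯]⁺ : ∀ {n x} → 1 ≤ x → x ≤ n → x ∈ [1⋯ n ]
∈[1⋯]⁺ {x = suc x} _ x≤n = ∈-map⁺ suc (∈-upTo⁺ x≤n)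

∈[1⋯]⁻ : ∀ {n x} → x ∈ [1⋯ n ] → 1 ≤ x × x ≤ n
∈[1⋯]⁻ x∈ with _ , y∈ , refl ← ∈-map⁻ suc x∈ = s≤s z≤n , ∈-upTo⁻ y∈

letter≥1 : ∀ {n w x} → IsPermutation n w → x ∈ w → 1 ≤ x
letter≥1 ((_ , ∈[n]) , _) x∈ = proj₁ (∈[1⋯]⁻ (All.lookup ∈[n] x∈))

letter≤ : ∀ {n w x} → IsPermutation n w → x ∈ w → x ≤ n
letter≤ ((_ , ∈[n]) , _) x∈ = proj₂ (∈[1⋯]⁻ (All.lookup ∈[n] x∈))

perm-resp-↭ : ∀ {n v w} → v ↭ w → IsPermutation n v → IsPermutation n w
perm-resp-↭ v↭w ((len , ∈[n]) , v!) =
  (trans (sym (↭-length v↭w)) len , All-resp-↭ v↭w ∈[n]) , Unique-resp-↭ (setoid ℕ) (↭⇒↭ₛ v↭w) v!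

-- Relabelling letters around a removed value

<-cancel : ∀ {f : ℕ → ℕ} → (∀ {x y} → x < y → f x < f y) → ∀ {x y} → f x < f y → x < y
<-cancel mono {x} {y} fx<fy with <-cmp x y
... | tri< x<y _ _  = x<y
... | tri≈ _ refl _ = contradiction fx<fy (<-irrefl refl)
... | tri> _ _ x>y  = contradiction (mono x>y) (<-asym fx<fy)

-- The increasing enumeration of the naturals other than k.
skip : ℕ → ℕ → ℕ
skip zero    x       = suc x
skip (suc k) zero    = zero
skip (suc k) (suc x) = suc (skip k x)

skip-mono-< : ∀ k {x y} → x < y → skip k x < skip k y
skip-mono-< zero              x<y       = s≤s x<y
skip-mono-< (suc k) {zero}  {suc y} _   = s≤s z≤n
skip-mono-< (suc k) {suc x} {suc y} x<y = s≤s (skip-mono-< k (s≤s⁻¹ x<y))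

skip-cancel-< : ∀ k {x y} → skip k x < skip k y → x < y
skip-cancel-< k = <-cancel (skip-mono-< k)

skip-injective : ∀ k → Injective _≡_ _≡_ (skip k)
skip-injective k {x} {y} eq with <-cmp x y
... | tri< x<y _ _ = contradiction eq (<⇒≢ (skip-mono-< k x<y))
... | tri≈ _ x≡y _ = x≡y
... | tri> _ _ x>y = contradiction eq (>⇒≢ (skip-mono-< k x>y))

skip-≢ : ∀ k {x} → skip k x ≢ k
skip-≢ (suc k) {suc x} eq = skip-≢ k (suc-injective eq)

skip-≤ : ∀ m {x} → x ≤ m → skip (suc m) x ≤ m
skip-≤ m       {zero}  _   = z≤n
skip-≤ (suc m) {suc x} x≤m = s≤s (skip-≤ m (s≤s⁻¹ x≤m))

skip-≤⁻ : ∀ m {x} → skip (suc m) x ≤ m → x ≤ m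
skip-≤⁻ m       {zero}  _   = z≤n
skip-≤⁻ (suc m) {suc x} s≤m = s≤s (skip-≤⁻ m (s≤s⁻¹ s≤m))

skip-> : ∀ k {x} → k ≤ x → k < skip k x
skip-> zero            _   = s≤s z≤n
skip-> (suc k) {suc x} k≤x = s≤s (skip-> k (s≤s⁻¹ k≤x))

skip->⁻ : ∀ k {x} → k < skip k x → k ≤ x
skip->⁻ zero            _   = z≤n
skip->⁻ (suc k) {suc x} k<s = s≤s (skip->⁻ k (s≤s⁻¹ k<s))

skip-bound : ∀ k {n x} → x ≤ n → skip k x ≤ suc n
skip-bound zero            x≤n = s≤s x≤n
skip-bound (suc k) {x = zero} x≤n = z≤n
skip-bound (suc k) {suc n} {suc x} x≤n = s≤s (skip-bound k (s≤s⁻¹ x≤n))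

skip-bound⁻ : ∀ k {n x} → k ≤ suc n → skip k x ≤ suc n → x ≤ n
skip-bound⁻ zero                       _   s≤n = s≤s⁻¹ s≤n
skip-bound⁻ (suc k)           {x = zero}  _   _   = z≤n
skip-bound⁻ (suc zero)    {zero} {suc x} _        (s≤s ())
skip-bound⁻ (suc (suc k)) {zero} {suc x} (s≤s ()) _
skip-bound⁻ (suc k)   {suc n} {suc x} k≤n s≤n = s≤s (skip-bound⁻ k (s≤s⁻¹ k≤n) (s≤s⁻¹ s≤n))

skip-positive : ∀ m {x} → 1 ≤ x → 1 ≤ skip (suc m) x
skip-positive m {suc x} _ = s≤s z≤n

skip-positive⁻ : ∀ m {x} → 1 ≤ skip (suc m) x → 1 ≤ x
skip-positive⁻ m {suc x} _ = s≤s z≤n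

unskip : ∀ k {y} → k ≢ y → ∃[ x ] y ≡ skip k x
unskip zero    {zero}  k≢y = contradiction refl k≢y
unskip zero    {suc y} k≢y = y , refl
unskip (suc k) {zero}  k≢y = zero , refl
unskip (suc k) {suc y} k≢y with x , eq ← unskip k (k≢y ∘ cong suc) = suc x , cong suc eq

unskip-word : ∀ k {w} → All (k ≢_) w → ∃[ v ] w ≡ map (skip k) v
unskip-word k []           = [] , refl
unskip-word k (k≢y ∷ k≢) with x , refl ← unskip k k≢y | v , refl ← unskip-word k k≢ = x ∷ v , refl

-- Every permutation of [n + 1] is uniquely prepend m v, with m ≤ n and v a
-- permutation of [n].
prepend : ℕ → Word → Word
prepend m v = suc m ∷ map (skip (suc m)) v

prepend-injective : ∀ m → Injective _≡_ _≡_ (prepend m)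
prepend-injective m eq = map-injective (skip-injective (suc m)) (∷-injectiveʳ eq)

perm-prepend : ∀ {n m v} → m ≤ n → IsPermutation n v → IsPermutation (suc n) (prepend m v)
perm-prepend {m = m} {v} m≤n π@((len , _) , v!) =
  (cong suc (trans (length-map _ v) len) ,
   ∈[1⋯]⁺ (s≤s z≤n) (s≤s m≤n) ∷ All.tabulate bounds) ,
  All.tabulate fresh ∷ Unique.map⁺ (skip-injective (suc m)) v!
  where
  bounds : ∀ {x} → x ∈ map (skip (suc m)) v → x ∈ [1⋯ _ ]
  bounds x∈ with y , y∈ , refl ← ∈-map⁻ (skip (suc m)) x∈ =
    ∈[1⋯]⁺ (skip-positive m (letter≥1 π y∈)) (skip-bound (suc m) (letter≤ π y∈))

  fresh : ∀ {x} → x ∈ map (skip (suc m)) v → suc m ≢ x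
  fresh x∈ with y , y∈ , refl ← ∈-map⁻ (skip (suc m)) x∈ = skip-≢ (suc m) ∘ sym

perm-prepend⁻ : ∀ {n m v} → IsPermutation (suc n) (prepend m v) → m ≤ n × IsPermutation n v
perm-prepend⁻ {n} {m} {v} π@((len , _) , (_ ∷ w!)) = m≤n ,
  (trans (sym (length-map _ v)) (suc-injective len) , All.tabulate bounds) , Unique.map⁻ w!
  where
  m≤n : m ≤ n
  m≤n = s≤s⁻¹ (letter≤ π (here refl))

  bounds : ∀ {x} → x ∈ v → x ∈ [1⋯ n ]
  bounds x∈ = ∈[1⋯]⁺
    (skip-positive⁻ m (letter≥1 π (there (∈-map⁺ _ x∈))))
    (skip-bound⁻ (suc m) (s≤s m≤n) (letter≤ π (there (∈-map⁺ _ x∈))))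

perm-unprepend : ∀ {n w} → IsPermutation (suc n) w → ∃₂ λ m v → w ≡ prepend m v
perm-unprepend {w = zero ∷ w} π with () ← letter≥1 π (here refl)
perm-unprepend {w = suc m ∷ w} (_ , m∉w ∷ _) with v , refl ← unskip-word (suc m) m∉w = m , v , refl

-- Pigeonhole by induction on n: a k other than the first letter is `skip (suc m) j`, and j occurs
-- in the shorter permutation.
perm-∈ : ∀ {n w k} → IsPermutation n w → 1 ≤ k → k ≤ n → k ∈ w
perm-∈ {suc n} {k = k} π 1≤k k≤n with m , v , refl ← perm-unprepend π with suc m ≟ k
... | yes refl = here refl
... | no m≢k with j , refl ← unskip (suc m) m≢k with m≤n , π′ ← perm-prepend⁻ π =
  there (∈-map⁺ _ (perm-∈ π′ (skip-positive⁻ m 1≤k) (skip-bound⁻ (suc m) (s≤s m≤n) k≤n)))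
perm-∈ {zero} π (s≤s z≤n) ()

perm-max∷⁺ : ∀ {n v} → IsPermutation n v → IsPermutation (suc n) (suc n ∷ v)
perm-max∷⁺ π@((len , _) , v!) =
  (cong suc len , ∈[1⋯]⁺ (s≤s z≤n) ≤-refl ∷
     All.tabulate λ x∈ → ∈[1⋯]⁺ (letter≥1 π x∈) (m≤n⇒m≤1+n (letter≤ π x∈))) ,
  All.tabulate (λ x∈ → >⇒≢ (s≤s (letter≤ π x∈))) ∷ v!

perm-max∷⁻ : ∀ {n v} → IsPermutation (suc n) (suc n ∷ v) → IsPermutation n v
perm-max∷⁻ π@((len , _) , n∉v ∷ v!) =
  (suc-injective len ,
   All.tabulate λ x∈ → ∈[1⋯]⁺ (letter≥1 π (there x∈))
     (s≤s⁻¹ (≤∧≢⇒< (letter≤ π (there x∈)) (≢-sym (All.lookup n∉v x∈))))) ,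
  v!

perm-∷ʳmax⁺ : ∀ {n v} → IsPermutation n v → IsPermutation (suc n) (v ∷ʳ suc n)
perm-∷ʳmax⁺ {n} {v} π = perm-resp-↭ (∷↭∷ʳ (suc n) v) (perm-max∷⁺ π)

perm-∷ʳmax⁻ : ∀ {n v} → IsPermutation (suc n) (v ∷ʳ suc n) → IsPermutation n v
perm-∷ʳmax⁻ {n} {v} π = perm-max∷⁻ (perm-resp-↭ (↭-sym (∷↭∷ʳ (suc n) v)) π)

-- Subsequences

pair-≢ : ∀ {a b : ℕ} {w} → Unique w → (a ∷ b ∷ []) ⊆ w → a ≢ b
pair-≢ (_ ∷ w!)  (_ ∷ˢ s)   = pair-≢ w! s
pair-≢ (a∉w ∷ _) (refl ∷ s) = All.lookup a∉w (to∈ s)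

map-⊆⁻ : ∀ {f : ℕ → ℕ} {σ} v → σ ⊆ map f v → ∃[ ρ ] (ρ ⊆ v × σ ≡ map f ρ)
map-⊆⁻ []      []         = [] , [] , refl
map-⊆⁻ (x ∷ v) (_ ∷ˢ s)   with ρ , s′ , eq ← map-⊆⁻ v s = ρ , x ∷ˢ s′ , eq
map-⊆⁻ (x ∷ v) (refl ∷ s) with ρ , s′ , eq ← map-⊆⁻ v s = x ∷ ρ , refl ∷ s′ , cong (_ ∷_) eq

⊆-∷ʳ⁻ : ∀ (σ : Word) {x} v {n} → (σ ∷ʳ x) ⊆ (v ∷ʳ n) → (σ ∷ʳ x) ⊆ v ⊎ x ≡ n
⊆-∷ʳ⁻ []          []      (refl ∷ []) = inj₂ refl
⊆-∷ʳ⁻ (_ ∷ [])    []      (_ ∷ ())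
⊆-∷ʳ⁻ (_ ∷ _ ∷ _) []      (_ ∷ ())
⊆-∷ʳ⁻ σ           (y ∷ v) (_ ∷ˢ s)    = [ (λ s′ → inj₁ (y ∷ˢ s′)) , inj₂ ]′ (⊆-∷ʳ⁻ σ v s)
⊆-∷ʳ⁻ []          (y ∷ v) (refl ∷ _)  = inj₁ (refl ∷ minimum v)
⊆-∷ʳ⁻ (_ ∷ σ)     (y ∷ v) (refl ∷ s)  = [ (λ s′ → inj₁ (refl ∷ s′)) , inj₂ ]′ (⊆-∷ʳ⁻ σ v s)

-- The length of ρ₁ tells where z stands among the letters of σ, so splitting on it runs through all
-- positions of an extra letter.
⊆-insert : ∀ {σ w : Word} {z} → σ ⊆ w → z ∈ w → z ∉ σ →
           ∃₂ λ ρ₁ ρ₂ → σ ≡ ρ₁ ++ ρ₂ × (ρ₁ ++ z ∷ ρ₂) ⊆ w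
⊆-insert (_ ∷ˢ s)   (here refl) z∉ = [] , _ , refl , refl ∷ s
⊆-insert (_ ∷ˢ s)   (there z∈)  z∉ with ρ₁ , ρ₂ , eq , s′ ← ⊆-insert s z∈ z∉ = ρ₁ , ρ₂ , eq , _ ∷ˢ s′
⊆-insert (refl ∷ s) (here refl) z∉ = contradiction (here refl) z∉
⊆-insert (refl ∷ s) (there z∈)  z∉ with ρ₁ , ρ₂ , refl , s′ ← ⊆-insert s z∈ (z∉ ∘ there) =
  _ ∷ ρ₁ , ρ₂ , refl , refl ∷ s′

two-letters : ∀ {w : Word} {x z} → x ∈ w → z ∈ w → z ≢ x → (z ∷ x ∷ []) ⊆ w ⊎ (x ∷ z ∷ []) ⊆ w
two-letters x∈ z∈ z≢x with ⊆-insert (from∈ x∈) z∈ (λ { (here refl) → z≢x refl })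
... | []     , _ , refl , s = inj₁ s
... | _ ∷ [] , _ , refl , s = inj₂ s

first-two : ∀ {a b : ℕ} {σ w} → (a ∷ b ∷ σ) ⊆ w → (a ∷ b ∷ []) ⊆ w
first-two = ⊆-trans (refl ∷ refl ∷ minimum _)

-- Patterns

-- Letters are named by rank, so the list of variables spells the pattern; comparing consecutive
-- ranks suffices by transitivity.
Avoids231 Avoids2143 Avoids2314 Avoids2341 : Word → Set
Avoids231  w = ∀ {a b c}   → (b ∷ c ∷ a ∷ []) ⊆ w     → a < b → b < c → ⊥
Avoids2143 w = ∀ {a b c d} → (b ∷ a ∷ d ∷ c ∷ []) ⊆ w → a < b → b < c → c < d → ⊥
Avoids2314 w = ∀ {a b c d} → (b ∷ c ∷ a ∷ d ∷ []) ⊆ w → a < b → b < c → c < d → ⊥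
Avoids2341 w = ∀ {a b c d} → (b ∷ c ∷ d ∷ a ∷ []) ⊆ w → a < b → b < c → c < d → ⊥

common-entry : ∀ (f g : ℕ → ℕ) τ (eq : length (map f τ) ≡ length (map g τ)) i →
  ∃[ x ] (lookup (map f τ) i ≡ f x × lookup (map g τ) (Fin.cast eq i) ≡ g x)
common-entry f g (x ∷ τ) eq zero    = x , refl , refl
common-entry f g (x ∷ τ) eq (suc i) = common-entry f g τ (suc-injective eq) i

orderIsomorphic-map : ∀ {f g} → (∀ {x y} → f x < f y ⇔ g x < g y) →
                      ∀ τ → OrderIsomorphic (map f τ) (map g τ)
orderIsomorphic-map {f} {g} f⇔g τ = eq , iso
  where
  eq : length (map f τ) ≡ length (map g τ)
  eq = trans (length-map f τ) (sym (length-map g τ))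

  iso : ∀ i j → lookup (map f τ) i < lookup (map f τ) j ⇔
                lookup (map g τ) (Fin.cast eq i) < lookup (map g τ) (Fin.cast eq j)
  iso i j with x , fx , gx ← common-entry f g τ eq i | y , fy , gy ← common-entry f g τ eq j
    rewrite fx | gx | fy | gy = f⇔g

step⇒mono-< : ∀ {f : ℕ → ℕ} → (∀ x → f x < f (suc x)) → ∀ {x y} → x < y → f x < f y
step⇒mono-< step {zero} {suc zero}    _   = step 0
step⇒mono-< step {zero} {suc (suc y)} _   = <-trans (step 0) (step⇒mono-< (step ∘ suc) (s≤s z≤n))
step⇒mono-< step {suc x} {suc y}      x<y = step⇒mono-< (step ∘ suc) (s≤s⁻¹ x<y)

-- An occurrence is the image of the zero-based pattern under this map, so its monotonicity yields
-- all the order isomorphisms at once. The values past 3 continue from d and keep it strictly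
-- increasing.
ladder : (a b c d : ℕ) → ℕ → ℕ
ladder a b c d 0                   = a
ladder a b c d 1                   = b
ladder a b c d 2                   = c
ladder a b c d (suc (suc (suc x))) = x + d

ladder⇔ : ∀ {a b c d x y} → a < b → b < c → c < d →
          ladder a b c d x < ladder a b c d y ⇔ suc x < suc y
ladder⇔ {a} {b} {c} {d} a<b b<c c<d = mk⇔ (s≤s ∘ <-cancel mono) (mono ∘ s≤s⁻¹)
  where
  step : ∀ x → ladder a b c d x < ladder a b c d (suc x)
  step 0                   = a<b
  step 1                   = b<c
  step 2                   = c<d
  step (suc (suc (suc x))) = n<1+n _

  mono : ∀ {x y} → x < y → ladder a b c d x < ladder a b c d y
  mono = step⇒mono-< step

orderIsomorphic-ladder : ∀ {a b c d} → a < b → b < c → c < d →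
                         ∀ τ → OrderIsomorphic (map (ladder a b c d) τ) (map suc τ)
orderIsomorphic-ladder {a} {b} {c} {d} a<b b<c c<d =
  orderIsomorphic-map (λ {x} {y} → ladder⇔ {x = x} {y} a<b b<c c<d)

avoids231⁺ : ∀ {w} → Avoids w (2 ∷ 3 ∷ 1 ∷ []) → Avoids231 w
avoids231⁺ av s a<b b<c =
  -- A pattern of length three leaves the top rung free; d = c + 1 fills it.
  av (_ , s , orderIsomorphic-ladder a<b b<c (n<1+n _) (1 ∷ 2 ∷ 0 ∷ []))

avoids231⁻ : ∀ {w} → Avoids231 w → Avoids w (2 ∷ 3 ∷ 1 ∷ [])
avoids231⁻ av (_ ∷ _ ∷ _ ∷ [] , s , refl , iso) =
  av s (from (iso (suc (suc zero)) zero) ≤-refl) (from (iso zero (suc zero)) ≤-refl)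

avoids2143⁺ : ∀ {w} → Avoids w (2 ∷ 1 ∷ 4 ∷ 3 ∷ []) → Avoids2143 w
avoids2143⁺ av s a<b b<c c<d =
  av (_ , s , orderIsomorphic-ladder a<b b<c c<d (1 ∷ 0 ∷ 3 ∷ 2 ∷ []))

avoids2143⁻ : ∀ {w} → Avoids2143 w → Avoids w (2 ∷ 1 ∷ 4 ∷ 3 ∷ [])
avoids2143⁻ av (_ ∷ _ ∷ _ ∷ _ ∷ [] , s , refl , iso) =
  av s (from (iso (suc zero) zero) ≤-refl)
       (from (iso zero (suc (suc (suc zero)))) ≤-refl)
       (from (iso (suc (suc (suc zero))) (suc (suc zero))) ≤-refl)

avoids2314⁺ : ∀ {w} → Avoids w (2 ∷ 3 ∷ 1 ∷ 4 ∷ []) → Avoids2314 w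
avoids2314⁺ av s a<b b<c c<d =
  av (_ , s , orderIsomorphic-ladder a<b b<c c<d (1 ∷ 2 ∷ 0 ∷ 3 ∷ []))

avoids2314⁻ : ∀ {w} → Avoids2314 w → Avoids w (2 ∷ 3 ∷ 1 ∷ 4 ∷ [])
avoids2314⁻ av (_ ∷ _ ∷ _ ∷ _ ∷ [] , s , refl , iso) =
  av s (from (iso (suc (suc zero)) zero) ≤-refl)
       (from (iso zero (suc zero)) ≤-refl)
       (from (iso (suc zero) (suc (suc (suc zero)))) ≤-refl)

avoids2341⁺ : ∀ {w} → Avoids w (2 ∷ 3 ∷ 4 ∷ 1 ∷ []) → Avoids2341 w
avoids2341⁺ av s a<b b<c c<d =
  av (_ , s , orderIsomorphic-ladder a<b b<c c<d (1 ∷ 2 ∷ 3 ∷ 0 ∷ []))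

avoids2341⁻ : ∀ {w} → Avoids2341 w → Avoids w (2 ∷ 3 ∷ 4 ∷ 1 ∷ [])
avoids2341⁻ av (_ ∷ _ ∷ _ ∷ _ ∷ [] , s , refl , iso) =
  av s (from (iso (suc (suc (suc zero))) zero) ≤-refl)
       (from (iso zero (suc zero)) ≤-refl)
       (from (iso (suc zero) (suc (suc zero))) ≤-refl)

-- The patterns 143, 314, 341 and 31 whose 1 is played by a letter ≤ m and
-- whose 3 and 4 are played by letters > m: what is left of 2143, 2314, 2341
-- and 231 once the 2 is prepended.
No143 No314 No341 No31 : ℕ → Word → Set
No143 m w = ∀ {a c d} → (a ∷ d ∷ c ∷ []) ⊆ w → a ≤ m → m < c → c < d → ⊥
No314 m w = ∀ {a c d} → (c ∷ a ∷ d ∷ []) ⊆ w → a ≤ m → m < c → c < d → ⊥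
No341 m w = ∀ {a c d} → (c ∷ d ∷ a ∷ []) ⊆ w → a ≤ m → m < c → c < d → ⊥
No31  m w = ∀ {a c}   → (c ∷ a ∷ []) ⊆ w     → a ≤ m → m < c → ⊥

module _ {m : ℕ} {v : Word} where

  private
    f : ℕ → ℕ
    f = skip (suc m)

    mono : ∀ {x y} → x < y → f x < f y
    mono = skip-mono-< (suc m)

    cancel : ∀ {x y} → f x < f y → x < y
    cancel = skip-cancel-< (suc m)

    low : ∀ {x} → f x < suc m → x ≤ m
    low = skip-≤⁻ m ∘ s≤s⁻¹

    high : ∀ {x} → suc m < f x → m < x
    high = skip->⁻ (suc m)

    low⁺ : ∀ {x} → x ≤ m → f x < suc m
    low⁺ = s≤s ∘ skip-≤ m

    high⁺ : ∀ {x} → m < x → suc m < f x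
    high⁺ = skip-> (suc m)

    lift : ∀ {σ} → σ ⊆ v → map f σ ⊆ map f v
    lift = Sublist.map⁺ f

  -- All four patterns begin with 2, so the new first letter can only be the 2 of an occurrence. The
  -- letters smaller than it come from letters ≤ m of v, the larger ones from letters > m.
  avoids231-prepend : Avoids231 v → No31 m v → Avoids231 (prepend m v)
  avoids231-prepend av av₁ (_ ∷ˢ s) a<b b<c
    with _ ∷ _ ∷ _ ∷ [] , s′ , refl ← map-⊆⁻ v s = av s′ (cancel a<b) (cancel b<c)
  avoids231-prepend av av₁ (refl ∷ s) a<b b<c
    with _ ∷ _ ∷ [] , s′ , refl ← map-⊆⁻ v s = av₁ s′ (low a<b) (high b<c)

  avoids2143-prepend : Avoids2143 v → No143 m v → Avoids2143 (prepend m v)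
  avoids2143-prepend av av₁ (_ ∷ˢ s) a<b b<c c<d
    with _ ∷ _ ∷ _ ∷ _ ∷ [] , s′ , refl ← map-⊆⁻ v s = av s′ (cancel a<b) (cancel b<c) (cancel c<d)
  avoids2143-prepend av av₁ (refl ∷ s) a<b b<c c<d
    with _ ∷ _ ∷ _ ∷ [] , s′ , refl ← map-⊆⁻ v s = av₁ s′ (low a<b) (high b<c) (cancel c<d)

  avoids2314-prepend : Avoids2314 v → No314 m v → Avoids2314 (prepend m v)
  avoids2314-prepend av av₁ (_ ∷ˢ s) a<b b<c c<d
    with _ ∷ _ ∷ _ ∷ _ ∷ [] , s′ , refl ← map-⊆⁻ v s = av s′ (cancel a<b) (cancel b<c) (cancel c<d)
  avoids2314-prepend av av₁ (refl ∷ s) a<b b<c c<d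
    with _ ∷ _ ∷ _ ∷ [] , s′ , refl ← map-⊆⁻ v s = av₁ s′ (low a<b) (high b<c) (cancel c<d)

  avoids2341-prepend : Avoids2341 v → No341 m v → Avoids2341 (prepend m v)
  avoids2341-prepend av av₁ (_ ∷ˢ s) a<b b<c c<d
    with _ ∷ _ ∷ _ ∷ _ ∷ [] , s′ , refl ← map-⊆⁻ v s = av s′ (cancel a<b) (cancel b<c) (cancel c<d)
  avoids2341-prepend av av₁ (refl ∷ s) a<b b<c c<d
    with _ ∷ _ ∷ _ ∷ [] , s′ , refl ← map-⊆⁻ v s = av₁ s′ (low a<b) (high b<c) (cancel c<d)

  avoids231-prepend⁻ : Avoids231 (prepend m v) → Avoids231 v × No31 m v
  avoids231-prepend⁻ av =
    (λ s a<b b<c → av (_ ∷ˢ lift s) (mono a<b) (mono b<c)) ,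
    (λ s a≤m m<c → av (refl ∷ lift s) (low⁺ a≤m) (high⁺ m<c))

  avoids2143-prepend⁻ : Avoids2143 (prepend m v) → Avoids2143 v × No143 m v
  avoids2143-prepend⁻ av =
    (λ s a<b b<c c<d → av (_ ∷ˢ lift s) (mono a<b) (mono b<c) (mono c<d)) ,
    (λ s a≤m m<c c<d → av (refl ∷ lift s) (low⁺ a≤m) (high⁺ m<c) (mono c<d))

  avoids2314-prepend⁻ : Avoids2314 (prepend m v) → Avoids2314 v × No314 m v
  avoids2314-prepend⁻ av =
    (λ s a<b b<c c<d → av (_ ∷ˢ lift s) (mono a<b) (mono b<c) (mono c<d)) ,
    (λ s a≤m m<c c<d → av (refl ∷ lift s) (low⁺ a≤m) (high⁺ m<c) (mono c<d))

  avoids2341-prepend⁻ : Avoids2341 (prepend m v) → Avoids2341 v × No341 m v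
  avoids2341-prepend⁻ av =
    (λ s a<b b<c c<d → av (_ ∷ˢ lift s) (mono a<b) (mono b<c) (mono c<d)) ,
    (λ s a≤m m<c c<d → av (refl ∷ lift s) (low⁺ a≤m) (high⁺ m<c) (mono c<d))

-- Decomposition by the first letter

Class : Set₁
Class = Word → Set

-- 231 is contained in 2314 and in 2341, so Narrow is the part of Wide avoiding 231.
Wide Narrow : Class
Wide   w = Avoids2143 w × Avoids2314 w × Avoids2341 w
Narrow w = Avoids231 w × Avoids2143 w

Members : Class → ℕ → Word → Set
Members C n w = IsPermutation n w × C w

-- Here q is the number of letters > m.
Tails : (ℕ → Class) → ℕ → ℕ → Word → Set
Tails D m q = Members (D m) (q + m)

WideTail NarrowTail : ℕ → Class
WideTail   m w = Wide w × No143 m w × No314 m w × No341 m w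
NarrowTail m w = Narrow w × No31 m w × No143 m w

-- Here D m must describe exactly the v for which `prepend m v` lies in C. The summands are disjoint
-- because the first letter determines m.
card-prepend : ∀ {C : Class} {D : ℕ → Class} {h n} →
  (∀ {m v} → D m v → C (prepend m v)) →
  (∀ {m v} → C (prepend m v) → D m v) →
  (∀ m q → HasCard (Tails D m q) (h m q)) →
  HasCard (Members C (suc n)) (antidiagonalSum h n)
card-prepend {C} {D} {n = n} D⇒C C⇒D card = card-cong
  (λ { (m , q , refl , v , (π , d) , refl) →
       perm-prepend (m≤m+n m q) (subst (λ k → IsPermutation k v) (+-comm q m) π) , D⇒C d })
  split
  (card-antidiagonal n
    (λ { (_ , _ , refl) (_ , _ , eq) → suc-injective (∷-injectiveˡ eq) })
    (λ m q → card-image (prepend-injective m) (card m q)))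
  where
  split : ∀ {w} → Members C (suc n) w →
          ∃₂ λ m q → m + q ≡ n × ∃[ v ] (Tails D m q v × w ≡ prepend m v)
  split (π , c)
    with m , v , refl ← perm-unprepend π
    with m≤n , π′ ← perm-prepend⁻ {m = m} {v} π =
    m , n ∸ m , m+[n∸m]≡n m≤n , v ,
    (subst (λ k → IsPermutation k v) (sym (m∸n+n≡m m≤n)) π′ , C⇒D c) , refl

card-wide : ∀ {h n} → (∀ m q → HasCard (Tails WideTail m q) (h m q)) →
            HasCard (Members Wide (suc n)) (antidiagonalSum h n)
card-wide = card-prepend
  (λ ((av₁ , av₂ , av₃) , no₁ , no₂ , no₃) →
     avoids2143-prepend av₁ no₁ , avoids2314-prepend av₂ no₂ , avoids2341-prepend av₃ no₃)
  (λ (av₁ , av₂ , av₃) →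
     let av₁ , no₁ = avoids2143-prepend⁻ av₁
         av₂ , no₂ = avoids2314-prepend⁻ av₂
         av₃ , no₃ = avoids2341-prepend⁻ av₃
     in (av₁ , av₂ , av₃) , no₁ , no₂ , no₃)

card-narrow : ∀ {h n} → (∀ m q → HasCard (Tails NarrowTail m q) (h m q)) →
              HasCard (Members Narrow (suc n)) (antidiagonalSum h n)
card-narrow = card-prepend
  (λ ((av₁ , av₂) , no₁ , no₂) → avoids231-prepend av₁ no₁ , avoids2143-prepend av₂ no₂)
  (λ (av₁ , av₂) →
     let av₁ , no₁ = avoids231-prepend⁻ av₁
         av₂ , no₂ = avoids2143-prepend⁻ av₂
     in (av₁ , av₂) , no₁ , no₂)

-- On permutations of [m + q]: a permutation of [m] followed by m + 1, …, m + q.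
TopSorted : ℕ → Class
TopSorted m w = ∀ {y x} → (y ∷ x ∷ []) ⊆ w → m < y → x < y → ⊥

Sorted : ℕ → Class
Sorted m w = Narrow w × TopSorted m w

max∷⁻ : ∀ {n w x} → IsPermutation (suc n) w → (suc n ∷ x ∷ []) ⊆ w → x < suc n
max∷⁻ π@(_ , w!) s = ≤∧≢⇒< (letter≤ π (⊆-lookup s (there (here refl)))) (≢-sym (pair-≢ w! s))

-- An appended maximum could only be the last letter of an occurrence, and neither 231, nor 2143,
-- nor a descent ends with its largest letter.
sorted-∷ʳ⁺ : ∀ {m n v} → IsPermutation n v → Sorted m v → Sorted m (v ∷ʳ suc n)
sorted-∷ʳ⁺ {m} {n} {v} π ((av₁ , av₂) , top) = (av₁′ , av₂′) , top′
  where
  bounded : ∀ {x} → x ∈ v ∷ʳ suc n → x ≤ suc n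
  bounded = letter≤ (perm-∷ʳmax⁺ π)

  av₁′ : Avoids231 (v ∷ʳ suc n)
  av₁′ {a} {b} {c} s a<b b<c with ⊆-∷ʳ⁻ (b ∷ c ∷ []) v s
  ... | inj₁ s′   = av₁ s′ a<b b<c
  ... | inj₂ refl = <⇒≱ a<b (bounded (⊆-lookup s (here refl)))

  av₂′ : Avoids2143 (v ∷ʳ suc n)
  av₂′ {a} {b} {c} {d} s a<b b<c c<d with ⊆-∷ʳ⁻ (b ∷ a ∷ d ∷ []) v s
  ... | inj₁ s′   = av₂ s′ a<b b<c c<d
  ... | inj₂ refl = <⇒≱ c<d (bounded (⊆-lookup s (there (there (here refl)))))

  top′ : TopSorted m (v ∷ʳ suc n)
  top′ {y} {x} s m<y x<y with ⊆-∷ʳ⁻ (y ∷ []) v s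
  ... | inj₁ s′   = top s′ m<y x<y
  ... | inj₂ refl = <⇒≱ x<y (bounded (⊆-lookup s (here refl)))

-- The maximum exceeds m, so any letter after it would form a forbidden descent.
sorted-∷ʳ⁻ : ∀ {m n w} → m ≤ n → IsPermutation (suc n) w → Sorted m w →
             ∃[ v ] (Members (Sorted m) n v × w ≡ v ∷ʳ suc n)
sorted-∷ʳ⁻ {m} {n} m≤n π ((av₁ , av₂) , top) with ∈-∃++ (perm-∈ π (s≤s z≤n) ≤-refl)
... | v , [] , refl = v ,
  (perm-∷ʳmax⁻ π ,
   ((λ s → av₁ (widen s)) , (λ s → av₂ (widen s))) , (λ s → top (widen s))) ,
  refl
  where
  widen : ∀ {σ} → σ ⊆ v → σ ⊆ v ∷ʳ suc n
  widen = Sublist.++⁺ʳ [ suc n ]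
... | v , x ∷ u , refl = ⊥-elim (top s (s≤s m≤n) (max∷⁻ π s))
  where
  s : (suc n ∷ x ∷ []) ⊆ v ++ suc n ∷ x ∷ u
  s = Sublist.++⁺ˡ v (refl ∷ refl ∷ minimum u)

-- Removing the final maximum q times leaves a narrow permutation of [m], so the count is
-- independent of q. At q = 0 no letter exceeds m and `TopSorted` is vacuous.
card-sorted : ∀ {m k} → HasCard (Members Narrow m) k → ∀ q → HasCard (Tails Sorted m q) k
card-sorted card zero = card-cong
  (λ (π , av) → π , av , λ s m<y _ → <⇒≱ m<y (letter≤ π (⊆-lookup s (here refl))))
  (λ (π , av , _) → π , av)
  card
card-sorted {m} card (suc q) = card-cong
  (λ { (v , (π , srt) , refl) → perm-∷ʳmax⁺ π , sorted-∷ʳ⁺ π srt })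
  (λ (π , srt) → sorted-∷ʳ⁻ (m≤n+m m q) π srt)
  (card-image (∷ʳ-injectiveˡ _ _) (card-sorted card q))

-- Comparison of tails with sorted words

module _ {m q : ℕ} {w : Word} (π : IsPermutation (q + m) w) where

  private
    low∈ : 1 ≤ m → 1 ∈ w
    low∈ 1≤m = perm-∈ π ≤-refl (≤-trans 1≤m (m≤n+m m q))

  -- As 31 is excluded, a descent from y > m ends at some x > m. The letter 1 ≤ m then makes 143 if
  -- it precedes y, and 31 if it comes later.
  narrowTail⇒sorted : 1 ≤ m → NarrowTail m w → Sorted m w
  narrowTail⇒sorted 1≤m (av , no31 , no143) = av , top
    where
    top : TopSorted m w
    top {y} {x} s m<y x<y with x ≤? m
    ... | yes x≤m = no31 s x≤m m<y
    ... | no x≰m with ≰⇒> x≰m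
    ... | m<x with ⊆-insert s (low∈ 1≤m)
                   (λ { (here refl) → <⇒≱ m<y 1≤m ; (there (here refl)) → <⇒≱ m<x 1≤m })
    ... | []        , _ , refl , s′ = no143 s′ 1≤m m<x x<y
    ... | _ ∷ []    , _ , refl , s′ = no31 (first-two s′) 1≤m m<y
    ... | _ ∷ _ ∷ [] , _ , refl , s′ = no31 (Sublist.∷ˡ⁻ s′) 1≤m m<x

  sorted⇒narrowTail : Sorted m w → NarrowTail m w
  sorted⇒narrowTail (av , top) = av ,
    (λ s a≤m m<c → top s m<c (≤-<-trans a≤m m<c)) ,
    (λ s a≤m m<c c<d → top (Sublist.∷ˡ⁻ s) (<-trans m<c c<d) c<d)

  -- Both 2314 and 2341 contain 231, and each of 143, 314, 341 contains a descent from a letter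
  -- above m.
  sorted⇒wideTail : Sorted m w → WideTail m w
  sorted⇒wideTail ((av231 , av2143) , top) =
    (av2143 ,
     (λ s a<b b<c _ → av231 (⊆-trans (refl ∷ refl ∷ refl ∷ minimum _) s) a<b b<c) ,
     (λ s a<b b<c _ → av231 (⊆-trans (refl ∷ refl ∷ _ ∷ˢ refl ∷ []) s) a<b b<c)) ,
    (λ s a≤m m<c c<d → top (Sublist.∷ˡ⁻ s) (<-trans m<c c<d) c<d) ,
    (λ s a≤m m<c c<d → top (first-two s) m<c (≤-<-trans a≤m m<c)) ,
    (λ s a≤m m<c c<d → top (Sublist.∷ˡ⁻ s) (<-trans m<c c<d) (≤-<-trans a≤m (<-trans m<c c<d)))

module _ {m q h : ℕ} {v : Word} (π : IsPermutation (2 + q + m) (h ∷ v)) (h≤m : h ≤ m) where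

  private
    w : Word
    w = h ∷ v

    m<max : m < 2 + q + m
    m<max = s≤s (m≤n⇒m≤1+n (m≤n+m m q))

    max∈ : 2 + q + m ∈ w
    max∈ = perm-∈ π (s≤s z≤n) ≤-refl

    -- The second letter > m is where q ≥ 2 enters.
    other-high : ∀ y → ∃[ z ] (z ∈ w × m < z × z ≢ y)
    other-high y with 2 + q + m ≟ y
    ... | no max≢y = 2 + q + m , max∈ , m<max , max≢y
    ... | yes refl = 1 + q + m , perm-∈ π (s≤s z≤n) (n≤1+n _) , s≤s (m≤n+m m q) , <⇒≢ ≤-refl

  -- The low first letter h makes the letters above m increase. A descent from one of them to a low
  -- letter, joined by a second high letter, would give 314 or 341.
  wideTail⇒sorted : WideTail m w → Sorted m w
  wideTail⇒sorted ((av2143 , av2314 , av2341) , no143 , no314 , no341) = (av231 , av2143) , top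
    where
    below-high : ∀ {y x} → (y ∷ x ∷ []) ⊆ w → m < y → x < y → x ≤ m
    below-high (refl ∷ s) m<y x<y = contradiction h≤m (<⇒≱ m<y)
    -- Two high letters y > x in this order would form 143 with h as the 1.
    below-high (_ ∷ˢ s)   m<y x<y = ≮⇒≥ λ m<x → no143 (refl ∷ s) h≤m m<x x<y

    ascending : ∀ {y z} → (y ∷ z ∷ []) ⊆ w → m < y → m < z → y < z
    ascending {y} {z} s m<y m<z with <-cmp y z
    ... | tri< y<z _ _  = y<z
    ... | tri≈ _ y≡z _ = contradiction y≡z (pair-≢ (proj₂ π) s)
    ... | tri> _ _ z<y  = contradiction (below-high s m<y z<y) (<⇒≱ m<z)

    top : TopSorted m w
    top {y} {x} s m<y x<y with x≤m ← below-high s m<y x<y | z , z∈ , m<z , z≢y ← other-high y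
      with ⊆-insert s z∈ (λ { (here refl) → z≢y refl ; (there (here refl)) → <⇒≱ m<z x≤m })
    ... | []         , _ , refl , s′ = no341 s′ x≤m m<z (ascending (first-two s′) m<z m<y)
    ... | _ ∷ []     , _ , refl , s′ = no341 s′ x≤m m<y (ascending (first-two s′) m<y m<z)
    ... | _ ∷ _ ∷ [] , _ , refl , s′ =
      no314 s′ x≤m m<y (ascending (⊆-trans (refl ∷ _ ∷ˢ refl ∷ []) s′) m<y m<z)

    av231 : Avoids231 w
    av231 {a} {b} {c} s a<b b<c
      -- A c above m would descend to a. With c ≤ m all three letters lie below the maximum, which
      -- must follow them, since nothing may descend from it; this completes a 2314.
      with c≤m ← ≮⇒≥ (λ m<c → top (Sublist.∷ˡ⁻ s) m<c (<-trans a<b b<c))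
      with c<max ← ≤-<-trans c≤m m<max
      with b<max ← <-trans b<c c<max
      with a<max ← <-trans a<b b<max
      with ⊆-insert s max∈ (λ { (here refl) → <-irrefl refl b<max
                              ; (there (here refl)) → <-irrefl refl c<max
                              ; (there (there (here refl))) → <-irrefl refl a<max })
    ... | []             , _ , refl , s′ = top (first-two s′) m<max b<max
    ... | _ ∷ []         , _ , refl , s′ = top (first-two (Sublist.∷ˡ⁻ s′)) m<max c<max
    ... | _ ∷ _ ∷ []     , _ , refl , s′ = top (Sublist.∷ˡ⁻ (Sublist.∷ˡ⁻ s′)) m<max a<max
    ... | _ ∷ _ ∷ _ ∷ [] , _ , refl , s′ = av2314 s′ a<b b<c c<max

-- Tails with a leading maximum, and the cases m = 0 and q ≤ 1

wideTail-max∷⁺ : ∀ {m n v} → m ≤ n → IsPermutation n v → WideTail m v → WideTail m (suc n ∷ v)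
wideTail-max∷⁺ {m} {n} {v} m≤n π ((av₁ , av₂ , av₃) , no₁ , no₂ , no₃) =
  (av₁′ , av₂′ , av₃′) , no₁′ , no₂′ , no₃′
  where
  maximal : ∀ {σ x} → σ ⊆ v → x ∈ σ → ¬ suc n < x
  maximal s x∈ = <⇒≯ (s≤s (letter≤ π (⊆-lookup s x∈)))

  av₁′ : Avoids2143 (suc n ∷ v)
  av₁′ (_ ∷ˢ s)   a<b b<c c<d = av₁ s a<b b<c c<d
  av₁′ (refl ∷ s) a<b b<c c<d = maximal s (there (there (here refl))) b<c

  av₂′ : Avoids2314 (suc n ∷ v)
  av₂′ (_ ∷ˢ s)   a<b b<c c<d = av₂ s a<b b<c c<d
  av₂′ (refl ∷ s) a<b b<c c<d = maximal s (here refl) b<c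

  av₃′ : Avoids2341 (suc n ∷ v)
  av₃′ (_ ∷ˢ s)   a<b b<c c<d = av₃ s a<b b<c c<d
  av₃′ (refl ∷ s) a<b b<c c<d = maximal s (here refl) b<c

  no₁′ : No143 m (suc n ∷ v)
  no₁′ (_ ∷ˢ s)   a≤m m<c c<d = no₁ s a≤m m<c c<d
  no₁′ (refl ∷ s) a≤m m<c c<d = <⇒≱ a≤m m≤n

  no₂′ : No314 m (suc n ∷ v)
  no₂′ (_ ∷ˢ s)   a≤m m<c c<d = no₂ s a≤m m<c c<d
  no₂′ (refl ∷ s) a≤m m<c c<d = maximal s (there (here refl)) c<d

  no₃′ : No341 m (suc n ∷ v)
  no₃′ (_ ∷ˢ s)   a≤m m<c c<d = no₃ s a≤m m<c c<d
  no₃′ (refl ∷ s) a≤m m<c c<d = maximal s (here refl) c<d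

wideTail-∷⁻ : ∀ {m x v} → WideTail m (x ∷ v) → WideTail m v
wideTail-∷⁻ ((av₁ , av₂ , av₃) , no₁ , no₂ , no₃) =
  ((λ s → av₁ (_ ∷ˢ s)) , (λ s → av₂ (_ ∷ˢ s)) , (λ s → av₃ (_ ∷ˢ s))) ,
  (λ s → no₁ (_ ∷ˢ s)) , (λ s → no₂ (_ ∷ˢ s)) , (λ s → no₃ (_ ∷ˢ s))

-- The first letter h decides: if h ≤ m the word is sorted, and if h is the maximum it can be
-- deleted. A value strictly between m and the maximum is impossible.
card-wideTail-step : ∀ {m q j k} → 1 ≤ m →
  HasCard (Tails WideTail m (1 + q)) j → HasCard (Tails Sorted m (2 + q)) k →
  HasCard (Tails WideTail m (2 + q)) (j + k)
card-wideTail-step {m} {q} 1≤m card₁ card₂ = card-cong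
  [ (λ { (v , (π , d) , refl) → perm-max∷⁺ π , wideTail-max∷⁺ (m≤n+m m (1 + q)) π d })
  , (λ (π , srt) → π , sorted⇒wideTail {q = 2 + q} π srt) ]′
  split
  (card-⊎ disjoint (card-image ∷-injectiveʳ card₁) card₂)
  where
  n : ℕ
  n = 1 + q + m

  m<sn : m < suc n
  m<sn = s≤s (m≤n+m m (1 + q))

  disjoint : ∀ {w} → ∃[ v ] (Tails WideTail m (1 + q) v × w ≡ suc n ∷ v) →
             ¬ Tails Sorted m (2 + q) w
  disjoint (v , (π , _) , refl) (_ , _ , top) =
    -- The second largest letter n follows the leading maximum, a descent from above m.
    top (refl ∷ from∈ (perm-∈ π (s≤s z≤n) ≤-refl)) m<sn ≤-refl

  split : ∀ {w} → Tails WideTail m (2 + q) w →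
          ∃[ v ] (Tails WideTail m (1 + q) v × w ≡ suc n ∷ v) ⊎ Tails Sorted m (2 + q) w
  split {[]} (((() , _) , _) , _)
  split {h ∷ v} (π , d@(_ , _ , no314 , no341)) with h ≤? m | h ≟ suc n
  ... | yes h≤m | _ = inj₂ (π , wideTail⇒sorted {q = q} π h≤m d)
  ... | no _    | yes refl = inj₁ (v , (perm-max∷⁻ π , wideTail-∷⁻ d) , refl)
  ... | no h≰m  | no h≢max = ⊥-elim impossible
    where
    m<h : m < h
    m<h = ≰⇒> h≰m

    h<max : h < suc n
    h<max = ≤∧≢⇒< (letter≤ π (here refl)) h≢max

    tail∈ : ∀ {x} → x ≢ h → x ∈ h ∷ v → x ∈ v
    tail∈ x≢h (here x≡h) = contradiction x≡h x≢h
    tail∈ x≢h (there x∈) = x∈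

    impossible : ⊥
    -- Both 1 and the maximum come after h; their order decides between 314 and 341.
    impossible with two-letters
      (tail∈ (≢-sym h≢max) (perm-∈ π (s≤s z≤n) ≤-refl))
      (tail∈ (<⇒≢ (≤-<-trans 1≤m m<h)) (perm-∈ π ≤-refl (s≤s z≤n)))
      (<⇒≢ (≤-<-trans 1≤m m<sn))
    ... | inj₁ s = no314 (refl ∷ s) 1≤m m<h h<max
    ... | inj₂ s = no341 (refl ∷ s) 1≤m m<h h<max

-- Each of 143, 314, 341 needs two distinct letters above m.
wideTail-≤1 : ∀ {m q w} → q ≤ 1 → IsPermutation (q + m) w → Wide w → WideTail m w
wideTail-≤1 {m} {q} {w} q≤1 π av = av ,
  (λ s _ → no-two (⊆-lookup s (there (here refl)))) ,
  (λ s _ → no-two (⊆-lookup s (there (there (here refl))))) ,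
  (λ s _ → no-two (⊆-lookup s (there (here refl))))
  where
  no-two : ∀ {c d} → d ∈ w → m < c → c < d → ⊥
  no-two d∈ m<c c<d = <⇒≱ (<-≤-trans (s≤s m<c) c<d) (≤-trans (letter≤ π d∈) (+-monoˡ-≤ m q≤1))

-- The 1 of 143, 314 or 341 would be a letter ≤ 0.
wideTail-0 : ∀ {n w} → IsPermutation n w → Wide w → WideTail 0 w
wideTail-0 π av = av ,
  (λ s a≤0 _ _ → <⇒≱ (letter≥1 π (⊆-lookup s (here refl))) a≤0) ,
  (λ s a≤0 _ _ → <⇒≱ (letter≥1 π (⊆-lookup s (there (here refl)))) a≤0) ,
  (λ s a≤0 _ _ → <⇒≱ (letter≥1 π (⊆-lookup s (there (there (here refl))))) a≤0)

narrowTail-0 : ∀ {n w} → IsPermutation n w → Narrow w → NarrowTail 0 w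
narrowTail-0 π av = av ,
  (λ s a≤0 _ → <⇒≱ (letter≥1 π (⊆-lookup s (there (here refl)))) a≤0) ,
  (λ s a≤0 _ _ → <⇒≱ (letter≥1 π (⊆-lookup s (here refl))) a≤0)

-- Numbers of tails and the resulting recurrences

-- This is X(m, q) for given sequences f and g, kept abstract so that the later recurrences are pure
-- arithmetic.
wideCount : (f g : ℕ → ℕ) → ℕ → ℕ → ℕ
wideCount f g zero    q             = f q
wideCount f g (suc m) zero          = f (1 + m)
wideCount f g (suc m) (suc zero)    = f (2 + m)
wideCount f g (suc m) (suc (suc q)) = wideCount f g (suc m) (suc q) + g (suc m)

narrowCount : (g : ℕ → ℕ) → ℕ → ℕ → ℕ
narrowCount g zero    q = g q
narrowCount g (suc m) q = g (suc m)

module _ {g : ℕ → ℕ} (card-g : ∀ n → HasCard (Members Narrow n) (g n)) where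

  card-narrowTail : ∀ m q → HasCard (Tails NarrowTail m q) (narrowCount g m q)
  card-narrowTail zero q rewrite +-identityʳ q = card-cong
    (λ (π , av) → π , narrowTail-0 π av)
    (λ (π , av , _) → π , av)
    (card-g q)
  card-narrowTail (suc m) q = card-cong
    (λ (π , srt) → π , sorted⇒narrowTail {q = q} π srt)
    (λ (π , d) → π , narrowTail⇒sorted {q = q} π (s≤s z≤n) d)
    (card-sorted (card-g (suc m)) q)

  narrow-recurrence : ∀ n → g (suc n) ≡ antidiagonalSum (narrowCount g) n
  narrow-recurrence n = card-unique (card-g (suc n)) (card-narrow card-narrowTail)

  module _ {f : ℕ → ℕ} (card-f : ∀ n → HasCard (Members Wide n) (f n)) where

    card-wideTail : ∀ m q → HasCard (Tails WideTail m q) (wideCount f g m q)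
    card-wideTail zero q rewrite +-identityʳ q = card-cong
      (λ (π , av) → π , wideTail-0 π av)
      (λ (π , av , _) → π , av)
      (card-f q)
    card-wideTail (suc m) zero = card-cong
      (λ (π , av) → π , wideTail-≤1 {q = 0} z≤n π av)
      (λ (π , av , _) → π , av)
      (card-f (1 + m))
    card-wideTail (suc m) (suc zero) = card-cong
      (λ (π , av) → π , wideTail-≤1 {q = 1} ≤-refl π av)
      (λ (π , av , _) → π , av)
      (card-f (2 + m))
    card-wideTail (suc m) (suc (suc q)) = card-wideTail-step (s≤s z≤n)
      (card-wideTail (suc m) (suc q))
      (card-sorted (card-g (suc m)) (2 + q))

    wide-recurrence : ∀ n → f (suc n) ≡ antidiagonalSum (wideCount f g) n
    wide-recurrence n = card-unique (card-f (suc n)) (card-wide card-wideTail)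

-- Power series

*-suc-coefficient : ∀ (f g : Series) n → (f * g) (suc n) ≡ f 0 ℤ.* g (suc n) ℤ.+ ((f ∘ suc) * g) n
*-suc-coefficient f g n = cong (λ ts → f 0 ℤ.* g (suc n) ℤ.+ foldr ℤ._+_ (+ 0) ts) (trans
  (map-applyUpTo suc (λ i → f i ℤ.* g (suc n ∸ i)) (suc n))
  (sym (map-upTo (λ i → f (suc i) ℤ.* g (n ∸ i)) (suc n))))

-- For g of degree at most d, the terms with i < k vanish. What remains is a window of d + 1
-- coefficients of f, at a fixed index where the product computes.
*-polynomial-coefficient : ∀ (f g : Series) d → (∀ k → g (suc (d + k)) ≡ + 0) →
  ∀ k → (f * g) (d + k) ≡ ((λ i → f (k + i)) * g) d
*-polynomial-coefficient f g d g≡0 zero rewrite +-identityʳ d = refl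
*-polynomial-coefficient f g d g≡0 (suc k) rewrite +-suc d k = begin
  (f * g) (suc (d + k))                                  ≡⟨ *-suc-coefficient f g (d + k) ⟩
  f 0 ℤ.* g (suc (d + k)) ℤ.+ ((f ∘ suc) * g) (d + k)    ≡⟨ cong (λ x → f 0 ℤ.* x ℤ.+ rest) (g≡0 k) ⟩
  f 0 ℤ.* + 0 ℤ.+ ((f ∘ suc) * g) (d + k)                ≡⟨ cong (ℤ._+ rest) (ℤ.*-zeroʳ (f 0)) ⟩
  + 0 ℤ.+ ((f ∘ suc) * g) (d + k)                        ≡⟨ ℤ.+-identityˡ _ ⟩
  ((f ∘ suc) * g) (d + k)                                ≡⟨ *-polynomial-coefficient (f ∘ suc) g d g≡0 k ⟩
  ((λ i → f (suc k + i)) * g) d                          ∎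
  where
  open ≡-Reasoning
  rest : ℤ
  rest = ((f ∘ suc) * g) (d + k)

numerator denominator₁ denominator₂ denominator : Series
numerator    = polynomial (+ 1 ∷ - (+ 6) ∷ + 10 ∷ - (+ 3) ∷ + 1 ∷ [])
denominator₁ = polynomial (+ 1 ∷ - (+ 3) ∷ + 1 ∷ [])
denominator₂ = polynomial (+ 1 ∷ - (+ 4) ∷ + 2 ∷ [])
denominator  = denominator₁ * denominator₂

-- The relevant window of `denominator₁` starts at index 3 + k, past its degree.
denominator-degree : ∀ k → denominator (5 + k) ≡ + 0
denominator-degree k = *-polynomial-coefficient denominator₁ denominator₂ 2 (λ _ → refl) (3 + k)

-- Recurrences

initialSum : (ℕ → ℕ) → ℕ → ℕ
initialSum c = antidiagonalSum (λ m _ → c m)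

initialSum-suc : ∀ c n → initialSum c (suc n) ≡ initialSum c n + c (suc n)
initialSum-suc c zero    = refl
initialSum-suc c (suc n) = trans
  (cong (λ x → c 0 + x) (initialSum-suc (c ∘ suc) n))
  (sym (+-assoc (c 0) _ _))

-- Lowering q by one carries antidiagonal n + 2 to antidiagonal n + 1 wherever q ≥ 2. The entries
-- with q ≤ 1 remain as boundary terms, placed so as to avoid subtraction.
antidiagonalSum-difference : ∀ (h : ℕ → ℕ → ℕ) (c : ℕ → ℕ) →
  (∀ m q → h m (2 + q) ≡ h m (1 + q) + c m) → ∀ n →
  antidiagonalSum h (2 + n) + h (1 + n) 0 ≡
  antidiagonalSum h (1 + n) + initialSum c n + (h (2 + n) 0 + h (1 + n) 1)
antidiagonalSum-difference h c step zero rewrite step 0 0 =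
  rearrange (h 0 1) (c 0) (h 1 1) (h 2 0) (h 1 0)
  where
  rearrange : ∀ x c y z u → x + c + (y + z) + u ≡ x + u + c + (z + y)
  rearrange = solveℕ-∀
antidiagonalSum-difference h c step (suc n) rewrite step 0 (suc n) = begin
  h 0 (2 + n) + c 0 + X + h (2 + n) 0       ≡⟨ +-assoc (h 0 (2 + n) + c 0) X _ ⟩
  h 0 (2 + n) + c 0 + (X + h (2 + n) 0)     ≡⟨ cong (λ x → h 0 (2 + n) + c 0 + x)
                                                  (antidiagonalSum-difference (h ∘ suc) (c ∘ suc) (step ∘ suc) n) ⟩
  h 0 (2 + n) + c 0 + (Y + Z + U)           ≡⟨ rearrange (h 0 (2 + n)) (c 0) Y Z U ⟩
  h 0 (2 + n) + Y + (c 0 + Z) + U           ∎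
  where
  open ≡-Reasoning
  X Y Z U : ℕ
  X = antidiagonalSum (h ∘ suc) (2 + n)
  Y = antidiagonalSum (h ∘ suc) (1 + n)
  Z = initialSum (c ∘ suc) n
  U = h (3 + n) 0 + h (2 + n) 1
  rearrange : ∀ x c y z u → x + c + (y + z + u) ≡ x + y + (c + z) + u
  rearrange = solveℕ-∀

module _ {f g : ℕ → ℕ}
  (f-rec : ∀ n → f (suc n) ≡ antidiagonalSum (wideCount f g) n)
  (g-rec : ∀ n → g (suc n) ≡ antidiagonalSum (narrowCount g) n)
  where

  private
    -- Thus s n = g 1 + ⋯ + g (n + 1), and W n is the part m ≥ 1 of the sum for f (2 + n).
    s W : ℕ → ℕ
    s = initialSum (g ∘ suc)
    W = antidiagonalSum (wideCount f g ∘ suc)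

  -- The row m = 0 contributes f (3 + n), and the difference lemma treats the rows m ≥ 1. Its
  -- boundary terms are X(n + 2, 0) = f (2 + n) and X(n + 3, 0) = X(n + 2, 1) = f (3 + n).
  f-step : ∀ n → f (4 + n) + (f (2 + n) + f (2 + n)) ≡
                 f (3 + n) + f (3 + n) + f (3 + n) + f (3 + n) + s n
  f-step n = begin
    f (4 + n) + (f₂ + f₂)           ≡⟨ cong (_+ (f₂ + f₂)) (f-rec (3 + n)) ⟩
    f₃ + W (2 + n) + (f₂ + f₂)      ≡⟨ lemma₁ f₃ (W (2 + n)) f₂ ⟩
    f₃ + f₂ + (W (2 + n) + f₂)      ≡⟨ cong (λ x → f₃ + f₂ + x)
                                         (antidiagonalSum-difference (wideCount f g ∘ suc) (g ∘ suc) (λ _ _ → refl) n) ⟩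
    f₃ + f₂ + (W (1 + n) + s n + (f₃ + f₃)) ≡⟨ lemma₂ f₃ f₂ (W (1 + n)) (s n) ⟩
    (f₂ + W (1 + n)) + f₃ + f₃ + f₃ + s n   ≡⟨ cong (λ x → x + f₃ + f₃ + f₃ + s n) (f-rec (2 + n)) ⟨
    f₃ + f₃ + f₃ + f₃ + s n         ∎
    where
    open ≡-Reasoning
    f₂ f₃ : ℕ
    f₂ = f (2 + n)
    f₃ = f (3 + n)
    lemma₁ : ∀ x w y → x + w + (y + y) ≡ x + y + (w + y)
    lemma₁ = solveℕ-∀
    lemma₂ : ∀ x y w z → x + y + (w + z + (x + x)) ≡ (y + w) + x + x + x + z
    lemma₂ = solveℕ-∀

  s-suc : ∀ n → s (suc n) ≡ s n + g (2 + n)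
  s-suc = initialSum-suc (g ∘ suc)

  s-step : ∀ n → s (2 + n) + s n ≡ s (1 + n) + s (1 + n) + s (1 + n)
  s-step n = begin
    s (2 + n) + s n                              ≡⟨ cong (_+ s n) (s-suc (suc n)) ⟩
    -- For m ≥ 1 `narrowCount` ignores q, so these rows add up to s (1 + n) by definition.
    s (1 + n) + g (3 + n) + s n                  ≡⟨ cong (λ x → s (1 + n) + x + s n) (g-rec (2 + n)) ⟩
    s (1 + n) + (g (2 + n) + s (1 + n)) + s n    ≡⟨ lemma (s (1 + n)) (g (2 + n)) (s n) ⟩
    s (1 + n) + s (1 + n) + (s n + g (2 + n))    ≡⟨ cong (λ x → s (1 + n) + s (1 + n) + x) (s-suc n) ⟨
    s (1 + n) + s (1 + n) + s (1 + n)            ∎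
    where
    open ≡-Reasoning
    lemma : ∀ x y z → x + (y + x) + z ≡ x + x + (z + y)
    lemma = solveℕ-∀

  -- The coefficients are those of (1 - 3x + x²)(1 - 4x + 2x²), arranged as the coefficient of index
  -- 4 of the product unfolds.
  f-linear : ∀ n →
    + f (2 + n) ℤ.* + 2 ℤ.+ (+ f (3 + n) ℤ.* - (+ 10) ℤ.+ (+ f (4 + n) ℤ.* + 15 ℤ.+
      (+ f (5 + n) ℤ.* - (+ 7) ℤ.+ (+ f (6 + n) ℤ.* + 1 ℤ.+ + 0)))) ≡ + 0
  f-linear n = trans
    -- Applying 1 - 3x + x² to `f-step` leaves only the combination of s that `s-step` annihilates.
    (combine (+ f (2 + n)) (+ f (3 + n)) (+ f (4 + n)) (+ f (5 + n)) (+ f (6 + n))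
             (+ s n) (+ s (1 + n)) (+ s (2 + n)))
    (vanish (difference (f-step (2 + n))) (difference (f-step (1 + n)))
            (difference (f-step n)) (difference (s-step n)))
    where
    difference : ∀ {x y : ℕ} → x ≡ y → + x ℤ.- + y ≡ + 0
    difference {x} refl = ℤ.+-inverseʳ (+ x)

    vanish : ∀ {x y z u} → x ≡ + 0 → y ≡ + 0 → z ≡ + 0 → u ≡ + 0 →
             x ℤ.- + 3 ℤ.* y ℤ.+ z ℤ.+ u ≡ + 0
    vanish refl refl refl refl = refl

    combine : ∀ f₂ f₃ f₄ f₅ f₆ s₀ s₁ s₂ →
      f₂ ℤ.* + 2 ℤ.+ (f₃ ℤ.* - (+ 10) ℤ.+ (f₄ ℤ.* + 15 ℤ.+ (f₅ ℤ.* - (+ 7) ℤ.+ (f₆ ℤ.* + 1 ℤ.+ + 0))))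
      ≡ ((f₆ ℤ.+ (f₄ ℤ.+ f₄)) ℤ.- (f₅ ℤ.+ f₅ ℤ.+ f₅ ℤ.+ f₅ ℤ.+ s₂))
        ℤ.- + 3 ℤ.* ((f₅ ℤ.+ (f₃ ℤ.+ f₃)) ℤ.- (f₄ ℤ.+ f₄ ℤ.+ f₄ ℤ.+ f₄ ℤ.+ s₁))
        ℤ.+ ((f₄ ℤ.+ (f₂ ℤ.+ f₂)) ℤ.- (f₃ ℤ.+ f₃ ℤ.+ f₃ ℤ.+ f₃ ℤ.+ s₀))
        ℤ.+ ((s₂ ℤ.+ s₀) ℤ.- (s₁ ℤ.+ s₁ ℤ.+ s₁))
    combine = solveℤ-∀

  module _ (f0 : f 0 ≡ 1) (g0 : g 0 ≡ 1) where

    g1 : g 1 ≡ 1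
    g1 = trans (g-rec 0) g0

    g2 : g 2 ≡ 2
    g2 rewrite g-rec 1 | g1 = refl

    f1 : f 1 ≡ 1
    f1 = trans (f-rec 0) f0

    f2 : f 2 ≡ 2
    f2 rewrite f-rec 1 | f1 = refl

    f3 : f 3 ≡ 6
    f3 rewrite f-rec 2 | f2 = refl

    f4 : f 4 ≡ 21
    f4 rewrite f-rec 3 | f3 | f2 | g1 = refl

    f5 : f 5 ≡ 75
    f5 rewrite f-rec 4 | f4 | f3 | f2 | g1 | g2 = refl

    -- The relation `f-linear` starts at f 2 and so covers the coefficients from index 6 on; the
    -- earlier ones are computed from f 0, ..., f 5.
    generating-function : (λ n → + f n) * denominator ≗ numerator
    generating-function 0 rewrite f0 = refl
    generating-function 1 rewrite f0 | f1 = refl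
    generating-function 2 rewrite f0 | f1 | f2 = refl
    generating-function 3 rewrite f0 | f1 | f2 | f3 = refl
    generating-function 4 rewrite f0 | f1 | f2 | f3 | f4 = refl
    generating-function 5 rewrite f0 | f1 | f2 | f3 | f4 | f5 = refl
    generating-function (suc (suc (suc (suc (suc (suc n)))))) = trans
      (*-polynomial-coefficient (λ i → + f i) denominator 4 denominator-degree (2 + n))
      window
      where
      window : ((λ i → + f (2 + n + i)) * denominator) 4 ≡ + 0
      window rewrite +-comm n 0 | +-comm n 1 | +-comm n 2 | +-comm n 3 | +-comm n 4 = f-linear n

-- The classes as avoidance sets, and the theorem

narrowPatterns : List Word
narrowPatterns = (2 ∷ 3 ∷ 1 ∷ []) ∷ (2 ∷ 1 ∷ 4 ∷ 3 ∷ []) ∷ []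

widePatterns : List Word
widePatterns = (2 ∷ 1 ∷ 4 ∷ 3 ∷ []) ∷ (2 ∷ 3 ∷ 1 ∷ 4 ∷ []) ∷ (2 ∷ 3 ∷ 4 ∷ 1 ∷ []) ∷ []

card-S : ∀ n T → HasCard (Members (AvoidsAll T) n) (length (S n T))
card-S n T = enum (S n T) (S-unique n T) ∈-S⇔ refl

card-S-narrow : ∀ n → HasCard (Members Narrow n) (length (S n narrowPatterns))
card-S-narrow n = card-cong
  (λ { (π , av₁ ∷ av₂ ∷ []) → π , avoids231⁺ av₁ , avoids2143⁺ av₂ })
  (λ { (π , av₁ , av₂) → π , avoids231⁻ av₁ ∷ avoids2143⁻ av₂ ∷ [] })
  (card-S n narrowPatterns)

card-S-wide : ∀ n → HasCard (Members Wide n) (length (S n widePatterns))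
card-S-wide n = card-cong
  (λ { (π , av₁ ∷ av₂ ∷ av₃ ∷ []) → π , avoids2143⁺ av₁ , avoids2314⁺ av₂ , avoids2341⁺ av₃ })
  (λ { (π , av₁ , av₂ , av₃) → π , avoids2143⁻ av₁ ∷ avoids2314⁻ av₂ ∷ avoids2341⁻ av₃ ∷ [] })
  (card-S n widePatterns)

theorem20 : let T = (2 ∷ 1 ∷ 4 ∷ 3 ∷ []) ∷ (2 ∷ 3 ∷ 1 ∷ 4 ∷ []) ∷ (2 ∷ 3 ∷ 4 ∷ 1 ∷ []) ∷ []
    in F T ≗ polynomial (+ 1 ∷ - (+ 6) ∷ + 10 ∷ - (+ 3) ∷ + 1 ∷ [])
    / (polynomial (+ 1 ∷ - (+ 3) ∷ + 1 ∷ []) * polynomial (+ 1 ∷ - (+ 4) ∷ + 2 ∷ []))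
-- The first `refl` is the constant term of the denominator; the last two say that the empty word is
-- the one permutation counted at n = 0.
theorem20 = refl , generating-function
  (wide-recurrence card-S-narrow card-S-wide) (narrow-recurrence card-S-narrow) refl refl
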